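{- Let $\mathbb{K}$ be a commutative ring with unit and $M$ a matroid. The Tutte polynomial of $M$ satisfies the following identity in $\mathbb{K}[x,y]$: $$\mathfrak{T}_M(x,y)=\sum_{F\text{ flat of }M}(x-1)^{\mathrm{rk}(M)-\mathrm{rk}(F)}\,\mathfrak{T}_{M|F}(1,y).$$
   Context: For a matroid $M$ with finite ground set $E(M)$ and rank function $\mathrm{rk}$, $\mathrm{rk}(M)=\mathrm{rk}(E(M))$, and the Tutte polynomial is $\mathfrak{T}_M(x,y)=\sum_{A\subseteq E(M)}(x-1)^{\mathrm{rk}(M)-\mathrm{rk}(A)}(y-1)^{|A|-\mathrm{rk}(A)}$. $M|F$ is the restriction of $M$ to $F$. -}

module Defs where

open import Algebra.Bundles using (CommutativeRing; CommutativeSemigroup)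
import Algebra.Properties.Semiring.Exp as SemiringExp
import Algebra.Properties.CommutativeSemigroup as CommutativeSemigroupProperties
open import Data.Bool.Base using (true; false)
open import Data.Fin.Base using (Fin)
import Data.Fin.Properties as Fin
open import Data.Fin.Subset using (Subset; inside; outside; _∈_; _∉_; _⊆_; _∪_; _∩_; ⁅_⁆; ∣_∣)
open import Data.Fin.Subset.Properties using (_∈?_; _⊆?_; p∩q⊆p)
open import Data.List.Base using (List; []; _∷_; map; foldr; filter; cartesianProductWith)
import Data.List.Membership.Propositional as Membership
open import Data.List.Membership.Propositional.Properties using (∈-cartesianProductWith⁺)
open import Data.List.Relation.Unary.Any using (here; there)
open import Data.List.Relation.Unary.All using ([]; _∷_)
open import Data.List.Relation.Unary.AllPairs using ([]; _∷_)
open import Data.List.Relation.Unary.Unique.Propositional using (Unique)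
import Data.List.Relation.Unary.Unique.Propositional.Properties as Unique
open import Data.Nat.Base using (ℕ; zero; suc; _∸_)
import Data.Nat.Base as ℕ
import Data.Nat.Properties as ℕ
open import Data.Product.Base using (_×_; _,_)
import Data.Vec.Base as Vec
open import Data.Vec.Properties using (∷-injective)
open import Function.Base using (_∘_)
open import Relation.Binary.PropositionalEquality using (refl)
open import Relation.Nullary using (Dec)
open import Relation.Nullary.Decidable using (_×-dec_; _→-dec_; ¬?)

------------------------------------------------------------------------
-- Matroids

-- The ground set E is a subset of an ambient finite set Fin n, so that a
-- matroid and its restrictions have the same type.  The value of rk on sets
-- not contained in E is irrelevant.

record Matroid (n : ℕ) : Set where
  field
    E             : Subset n
    rk            : Subset n → ℕ
    rk-≤-card     : ∀ {A} → A ⊆ E → rk A ℕ.≤ ∣ A ∣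
    rk-mono       : ∀ {A B} → A ⊆ B → B ⊆ E → rk A ℕ.≤ rk B
    rk-submodular : ∀ {A B} → A ⊆ E → B ⊆ E →
                    rk (A ∪ B) ℕ.+ rk (A ∩ B) ℕ.≤ rk A ℕ.+ rk B

  rank : ℕ
  rank = rk E

-- The ground set of the restriction is E ∩ F, which is F whenever F ⊆ E.

infixl 6 _↾_

_↾_ : ∀ {n} → Matroid n → Subset n → Matroid n
M ↾ F = record
  { E             = E ∩ F
  ; rk            = rk
  ; rk-≤-card     = λ A⊆ → rk-≤-card (inE A⊆)
  ; rk-mono       = λ A⊆B B⊆ → rk-mono A⊆B (inE B⊆)
  ; rk-submodular = λ A⊆ B⊆ → rk-submodular (inE A⊆) (inE B⊆)
  }
  where
  open Matroid M
  inE : ∀ {A} → A ⊆ E ∩ F → A ⊆ E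
  inE A⊆ x∈A = p∩q⊆p E F (A⊆ x∈A)

IsFlat : ∀ {n} → Matroid n → Subset n → Set
IsFlat M F = F ⊆ E × (∀ e → e ∈ E → e ∉ F → rk F ℕ.< rk (F ∪ ⁅ e ⁆))
  where open Matroid M

isFlat? : ∀ {n} (M : Matroid n) (F : Subset n) → Dec (IsFlat M F)
isFlat? M F = (F ⊆? E) ×-dec
  Fin.all? (λ e → (e ∈? E) →-dec (¬? (e ∈? F) →-dec (rk F ℕ.<? rk (F ∪ ⁅ e ⁆))))
  where open Matroid M

allSubsets : ∀ n → List (Subset n)
allSubsets zero    = Vec.[] ∷ []
allSubsets (suc n) = cartesianProductWith Vec._∷_ (outside ∷ inside ∷ []) (allSubsets n)

allSubsets-complete : ∀ {n} (A : Subset n) → A Membership.∈ allSubsets n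
allSubsets-complete Vec.[]            = here refl
allSubsets-complete (b Vec.∷ A) =
  ∈-cartesianProductWith⁺ Vec._∷_ (side b) (allSubsets-complete A)
  where
  side : ∀ b → b Membership.∈ (outside ∷ inside ∷ [])
  side false = here refl
  side true  = there (here refl)

allSubsets-unique : ∀ n → Unique (allSubsets n)
allSubsets-unique zero    = [] ∷ []
allSubsets-unique (suc n) =
  Unique.cartesianProductWith⁺ Vec._∷_ ∷-injective
    (((λ ()) ∷ []) ∷ [] ∷ []) (allSubsets-unique n)

subsets : ∀ {n} → Subset n → List (Subset n)
subsets {n} S = filter (_⊆? S) (allSubsets n)

flats : ∀ {n} → Matroid n → List (Subset n)
flats {n} M = filter (isFlat? M) (allSubsets n)

------------------------------------------------------------------------
-- Univariate polynomials over a commutative ring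

-- A polynomial is a list of coefficients, lowest degree first.  Trailing
-- zeros are allowed and ignored by the equality, which compares the
-- coefficients in every degree.

module Polynomial {c ℓ} (R : CommutativeRing c ℓ) where

  private
    module R = CommutativeRing R
    open import Algebra.Properties.Ring R.ring using (-0#≈0#)

  Poly : Set c
  Poly = List R.Carrier

  coeff : Poly → ℕ → R.Carrier
  coeff []      _       = R.0#
  coeff (a ∷ p) zero    = a
  coeff (a ∷ p) (suc i) = coeff p i

  infix 4 _≈_

  record _≈_ (p q : Poly) : Set ℓ where
    constructor coeffwise
    field
      at : ∀ i → coeff p i R.≈ coeff q i

  open _≈_ public

  infixl 6 _+_
  infixl 7 _*_ _·_
  infix  8 -_

  _+_ : Poly → Poly → Poly
  []      + q       = q
  (a ∷ p) + []      = a ∷ p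
  (a ∷ p) + (b ∷ q) = (a R.+ b) ∷ (p + q)

  -_ : Poly → Poly
  -_ = map (λ a → R.- a)

  _·_ : R.Carrier → Poly → Poly
  a · p = map (a R.*_) p

  X*_ : Poly → Poly
  X* p = R.0# ∷ p

  -- (a + X p) q = a q + X (p q)
  _*_ : Poly → Poly → Poly
  []      * q = []
  (a ∷ p) * q = a · q + X* (p * q)

  C : R.Carrier → Poly
  C a = a ∷ []

  X : Poly
  X = R.0# ∷ R.1# ∷ []

  private
    coeff-+ : ∀ p q i → coeff (p + q) i R.≈ coeff p i R.+ coeff q i
    coeff-+ []      q       i       = R.sym (R.+-identityˡ _)
    coeff-+ (a ∷ p) []      i       = R.sym (R.+-identityʳ _)
    coeff-+ (a ∷ p) (b ∷ q) zero    = R.refl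
    coeff-+ (a ∷ p) (b ∷ q) (suc i) = coeff-+ p q i

    coeff-neg : ∀ p i → coeff (- p) i R.≈ R.- coeff p i
    coeff-neg []      i       = R.sym -0#≈0#
    coeff-neg (a ∷ p) zero    = R.refl
    coeff-neg (a ∷ p) (suc i) = coeff-neg p i

    coeff-· : ∀ a p i → coeff (a · p) i R.≈ a R.* coeff p i
    coeff-· a []      i       = R.sym (R.zeroʳ a)
    coeff-· a (b ∷ p) zero    = R.refl
    coeff-· a (b ∷ p) (suc i) = coeff-· a p i

    ≈-refl : ∀ {p} → p ≈ p
    ≈-refl .at i = R.refl

    ≈-sym : ∀ {p q} → p ≈ q → q ≈ p
    ≈-sym e .at i = R.sym (e .at i)

    ≈-trans : ∀ {p q r} → p ≈ q → q ≈ r → p ≈ r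
    ≈-trans e f .at i = R.trans (e .at i) (f .at i)

    +-cong : ∀ {p p′ q q′} → p ≈ p′ → q ≈ q′ → p + q ≈ p′ + q′
    +-cong {p} {p′} {q} {q′} e f .at i =
      R.trans (coeff-+ p q i)
        (R.trans (R.+-cong (e .at i) (f .at i)) (R.sym (coeff-+ p′ q′ i)))

    +-assoc : ∀ p q r → (p + q) + r ≈ p + (q + r)
    +-assoc p q r .at i =
      R.trans (coeff-+ (p + q) r i)
        (R.trans (R.+-congʳ (coeff-+ p q i))
          (R.trans (R.+-assoc _ _ _)
            (R.trans (R.+-congˡ (R.sym (coeff-+ q r i))) (R.sym (coeff-+ p (q + r) i)))))

    +-comm : ∀ p q → p + q ≈ q + p
    +-comm p q .at i =
      R.trans (coeff-+ p q i) (R.trans (R.+-comm _ _) (R.sym (coeff-+ q p i)))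

    +-identityˡ : ∀ p → [] + p ≈ p
    +-identityˡ p = ≈-refl

    +-identityʳ : ∀ p → p + [] ≈ p
    +-identityʳ p = +-comm p []

    neg-cong : ∀ {p q} → p ≈ q → - p ≈ - q
    neg-cong {p} {q} e .at i =
      R.trans (coeff-neg p i) (R.trans (R.-‿cong (e .at i)) (R.sym (coeff-neg q i)))

    neg-inverseʳ : ∀ p → p + - p ≈ []
    neg-inverseʳ p .at i =
      R.trans (coeff-+ p (- p) i)
        (R.trans (R.+-congˡ (coeff-neg p i)) (R.-‿inverseʳ _))

    neg-inverseˡ : ∀ p → - p + p ≈ []
    neg-inverseˡ p = ≈-trans (+-comm (- p) p) (neg-inverseʳ p)

    open import Algebra.Structures {A = Poly} _≈_
      using (IsCommutativeMonoid; IsAbelianGroup; IsCommutativeRing)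

    +-isAbelianGroup : IsAbelianGroup _+_ [] -_
    +-isAbelianGroup = record
      { isGroup = record
        { isMonoid = record
          { isSemigroup = record
            { isMagma = record
              { isEquivalence = record { refl = ≈-refl ; sym = ≈-sym ; trans = ≈-trans }
              ; ∙-cong        = +-cong
              }
            ; assoc = +-assoc
            }
          ; identity = +-identityˡ , +-identityʳ
          }
        ; inverse = neg-inverseˡ , neg-inverseʳ
        ; ⁻¹-cong = neg-cong
        }
      ; comm = +-comm
      }

    open IsAbelianGroup +-isAbelianGroup using (setoid; isCommutativeMonoid)
    open import Relation.Binary.Reasoning.Setoid setoid

    +-commutativeSemigroup : CommutativeSemigroup c ℓ
    +-commutativeSemigroup = record
      { isCommutativeSemigroup =
          IsCommutativeMonoid.isCommutativeSemigroup isCommutativeMonoid }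

    open CommutativeSemigroupProperties +-commutativeSemigroup
      using (interchange; x∙yz≈y∙xz)

    ∷-cong : ∀ {a b p q} → a R.≈ b → p ≈ q → a ∷ p ≈ b ∷ q
    ∷-cong e f .at zero    = e
    ∷-cong e f .at (suc i) = f .at i

    X*-cong : ∀ {p q} → p ≈ q → X* p ≈ X* q
    X*-cong = ∷-cong R.refl

    X*-[] : X* [] ≈ []
    X*-[] .at zero    = R.refl
    X*-[] .at (suc i) = R.refl

    X*-+ : ∀ p q → X* (p + q) ≈ X* p + X* q
    X*-+ p q = ∷-cong (R.sym (R.+-identityˡ _)) ≈-refl

    ·-cong : ∀ {a b p q} → a R.≈ b → p ≈ q → a · p ≈ b · q
    ·-cong {a} {b} {p} {q} e f .at i =
      R.trans (coeff-· a p i) (R.trans (R.*-cong e (f .at i)) (R.sym (coeff-· b q i)))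

    0·≈[] : ∀ p → R.0# · p ≈ []
    0·≈[] p .at i = R.trans (coeff-· R.0# p i) (R.zeroˡ _)

    1·≈ : ∀ p → R.1# · p ≈ p
    1·≈ p .at i = R.trans (coeff-· R.1# p i) (R.*-identityˡ _)

    ·-+ : ∀ a p q → a · (p + q) ≈ a · p + a · q
    ·-+ a p q .at i =
      R.trans (coeff-· a (p + q) i)
        (R.trans (R.*-congˡ (coeff-+ p q i))
          (R.trans (R.distribˡ _ _ _)
            (R.trans (R.+-cong (R.sym (coeff-· a p i)) (R.sym (coeff-· a q i)))
              (R.sym (coeff-+ (a · p) (a · q) i)))))

    +-· : ∀ a b p → (a R.+ b) · p ≈ a · p + b · p
    +-· a b p .at i =
      R.trans (coeff-· (a R.+ b) p i)
        (R.trans (R.distribʳ _ _ _)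
          (R.trans (R.+-cong (R.sym (coeff-· a p i)) (R.sym (coeff-· b p i)))
            (R.sym (coeff-+ (a · p) (b · p) i))))

    ·-· : ∀ a b p → (a R.* b) · p ≈ a · (b · p)
    ·-· a b p .at i =
      R.trans (coeff-· (a R.* b) p i)
        (R.trans (R.*-assoc _ _ _)
          (R.trans (R.*-congˡ (R.sym (coeff-· b p i))) (R.sym (coeff-· a (b · p) i))))

    ·-X* : ∀ a p → a · (X* p) ≈ X* (a · p)
    ·-X* a p = ∷-cong (R.zeroʳ a) ≈-refl

    *-congˡ : ∀ p {q r} → q ≈ r → p * q ≈ p * r
    *-congˡ []      e = ≈-refl
    *-congˡ (a ∷ p) e = +-cong (·-cong R.refl e) (X*-cong (*-congˡ p e))

    *-zeroʳ : ∀ p → p * [] ≈ []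
    *-zeroʳ []      = ≈-refl
    *-zeroʳ (a ∷ p) = ≈-trans (X*-cong (*-zeroʳ p)) X*-[]

    *-∷ : ∀ p b q → p * (b ∷ q) ≈ b · p + X* (p * q)
    *-∷ []      b q = ≈-sym X*-[]
    *-∷ (a ∷ p) b q = ∷-cong (R.+-congʳ (R.*-comm a b)) (begin
      a · q + p * (b ∷ q)            ≈⟨ +-cong ≈-refl (*-∷ p b q) ⟩
      a · q + (b · p + X* (p * q))   ≈⟨ x∙yz≈y∙xz (a · q) (b · p) (X* (p * q)) ⟩
      b · p + (a · q + X* (p * q))   ∎)

    *-comm : ∀ p q → p * q ≈ q * p
    *-comm []      q = ≈-sym (*-zeroʳ q)
    *-comm (a ∷ p) q = begin
      a · q + X* (p * q)  ≈⟨ +-cong ≈-refl (X*-cong (*-comm p q)) ⟩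
      a · q + X* (q * p)  ≈⟨ *-∷ q a p ⟨
      q * (a ∷ p)         ∎

    *-cong : ∀ {p q r s} → p ≈ q → r ≈ s → p * r ≈ q * s
    *-cong {p} {q} {r} {s} e f = begin
      p * r  ≈⟨ *-congˡ p f ⟩
      p * s  ≈⟨ *-comm p s ⟩
      s * p  ≈⟨ *-congˡ s e ⟩
      s * q  ≈⟨ *-comm s q ⟩
      q * s  ∎

    *-distribˡ : ∀ p q r → p * (q + r) ≈ p * q + p * r
    *-distribˡ []      q r = ≈-refl
    *-distribˡ (a ∷ p) q r = begin
      a · (q + r) + X* (p * (q + r))
        ≈⟨ +-cong (·-+ a q r) (≈-trans (X*-cong (*-distribˡ p q r)) (X*-+ (p * q) (p * r))) ⟩
      (a · q + a · r) + (X* (p * q) + X* (p * r))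
        ≈⟨ interchange (a · q) (a · r) (X* (p * q)) (X* (p * r)) ⟩
      (a · q + X* (p * q)) + (a · r + X* (p * r)) ∎

    *-distribʳ : ∀ r p q → (p + q) * r ≈ p * r + q * r
    *-distribʳ r p q = begin
      (p + q) * r    ≈⟨ *-comm (p + q) r ⟩
      r * (p + q)    ≈⟨ *-distribˡ r p q ⟩
      r * p + r * q  ≈⟨ +-cong (*-comm r p) (*-comm r q) ⟩
      p * r + q * r  ∎

    ·-* : ∀ a p q → (a · p) * q ≈ a · (p * q)
    ·-* a []      q = ≈-refl
    ·-* a (b ∷ p) q = begin
      (a R.* b) · q + X* ((a · p) * q)
        ≈⟨ +-cong (·-· a b q) (≈-trans (X*-cong (·-* a p q)) (≈-sym (·-X* a (p * q)))) ⟩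
      a · (b · q) + a · (X* (p * q))
        ≈⟨ ·-+ a (b · q) (X* (p * q)) ⟨
      a · (b · q + X* (p * q)) ∎

    X*-* : ∀ p q → (X* p) * q ≈ X* (p * q)
    X*-* p q = +-cong (0·≈[] q) ≈-refl

    *-assoc : ∀ p q r → (p * q) * r ≈ p * (q * r)
    *-assoc []      q r = ≈-refl
    *-assoc (a ∷ p) q r = begin
      (a · q + X* (p * q)) * r        ≈⟨ *-distribʳ r (a · q) (X* (p * q)) ⟩
      (a · q) * r + (X* (p * q)) * r
        ≈⟨ +-cong (·-* a q r) (≈-trans (X*-* (p * q) r) (X*-cong (*-assoc p q r))) ⟩
      a · (q * r) + X* (p * (q * r))  ∎

    *-identityˡ : ∀ p → C R.1# * p ≈ p
    *-identityˡ p = begin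
      R.1# · p + X* []  ≈⟨ +-cong (1·≈ p) X*-[] ⟩
      p + []            ≈⟨ +-identityʳ p ⟩
      p                 ∎

    *-identityʳ : ∀ p → p * C R.1# ≈ p
    *-identityʳ p = ≈-trans (*-comm p (C R.1#)) (*-identityˡ p)

    isCommutativeRing : IsCommutativeRing _+_ _*_ -_ [] (C R.1#)
    isCommutativeRing = record
      { isRing = record
        { +-isAbelianGroup = +-isAbelianGroup
        ; *-cong           = *-cong
        ; *-assoc          = *-assoc
        ; *-identity       = *-identityˡ , *-identityʳ
        ; distrib          = *-distribˡ , *-distribʳ
        }
      ; *-comm = *-comm
      }

  commutativeRing : CommutativeRing c ℓ
  commutativeRing = record { isCommutativeRing = isCommutativeRing }

  -- The value of p at s after mapping its coefficients to S along f.
  module _ {c′ ℓ′} (S : CommutativeRing c′ ℓ′) where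
    private module S = CommutativeRing S

    eval : (R.Carrier → S.Carrier) → S.Carrier → Poly → S.Carrier
    eval f s []      = S.0#
    eval f s (a ∷ p) = f a S.+ s S.* eval f s p

------------------------------------------------------------------------
-- The ring K[x,y], constructed as K[x][y], and Tutte polynomials

module Bivariate {c ℓ} (K : CommutativeRing c ℓ) where

  private
    module K      = CommutativeRing K
    module K[x]   = Polynomial K
    module K[x,y] = Polynomial K[x].commutativeRing

  ring : CommutativeRing c ℓ
  ring = K[x,y].commutativeRing

  open CommutativeRing ring public
    using (Carrier; _≈_; _+_; _*_; _-_; 0#; 1#)
  open SemiringExp (CommutativeRing.semiring ring) public
    using (_^_)

  const : K.Carrier → Carrier
  const a = K[x,y].C (K[x].C a)

  x y : Carrier
  x = K[x,y].C K[x].X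
  y = K[x,y].X

  -- p ⟨ a , b ⟩ is p(a,b): the substitution x ↦ a, y ↦ b in p.
  infix 9 _⟨_,_⟩

  _⟨_,_⟩ : Carrier → Carrier → Carrier → Carrier
  p ⟨ a , b ⟩ = K[x,y].eval ring (K[x].eval ring const a) b p

  ∑ : ∀ {i} {I : Set i} → List I → (I → Carrier) → Carrier
  ∑ is f = foldr (λ i s → f i + s) 0# is

  infix 5 ∑
  syntax ∑ is (λ i → t) = ∑[ i ← is ] t

  -- The truncated subtractions are genuine ones: rk A ≤ rk E and
  -- rk A ≤ ∣ A ∣ for A ⊆ E.
  tutte : ∀ {n} → Matroid n → Carrier
  tutte M = ∑[ A ← subsets E ] ((x - 1#) ^ (rank ∸ rk A) * (y - 1#) ^ (∣ A ∣ ∸ rk A))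
    where open Matroid M

{-# OPTIONS --safe #-}

-- Substituting x = 1 in the Tutte polynomial of M|F leaves only the subsets A
-- of F of full rank rk F, because 0 ^ k vanishes unless k = 0.  On the right
-- hand side, interchanging the two sums therefore gives, for every subset A
-- of E, one term for each flat F ⊇ A with rk F = rk A.  There is exactly one
-- such flat, the closure of A, and its term is the term of A on the left.

module Submission where

open import Defs
open import Algebra.Bundles using (CommutativeRing)
open import Algebra.Morphism.Structures using (module RingMorphisms)
import Algebra.Properties.CommutativeSemigroup as CommutativeSemigroupProperties
import Algebra.Properties.Semiring.Exp as SemiringExp
import Data.Fin.Properties as Fin
open import Data.Fin.Subset
  using (Subset; _∈_; _⊆_; _⊂_; _∪_; _∩_; ⁅_⁆; ∣_∣)
open import Data.Fin.Subset.Induction using (⊃-wellFounded; Acc; acc)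
open import Data.Fin.Subset.Properties
  using (_∈?_; _⊆?_; ⊆-antisym; p∩q⊆p; p∩q⊆q; x∈p∩q⁺; p⊆p∪q; q⊆p∪q; x∈p∪q⁻;
         x∈⁅x⁆; x∈⁅y⁆⇒x≡y)
open import Data.List.Base using (List; []; _∷_; filter; foldr)
open import Data.List.Membership.Propositional using () renaming (_∈_ to _∈ₗ_)
open import Data.List.Membership.Propositional.Properties using (∈-filter⁺; ∈-filter⁻)
import Data.List.Relation.Unary.All as All
open import Data.List.Relation.Unary.AllPairs using (_∷_)
open import Data.List.Relation.Unary.Any using (here; there)
open import Data.List.Relation.Unary.Unique.Propositional using (Unique)
import Data.List.Relation.Unary.Unique.Propositional.Properties as Unique
open import Data.Nat.Base using (ℕ; zero; suc; _∸_)
import Data.Nat.Base as ℕ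
import Data.Nat.Properties as ℕ
open import Data.Product.Base using (∃-syntax; _×_; _,_; proj₁; proj₂)
open import Data.Sum.Base using ([_,_]′)
open import Function.Base using (_∘_)
open import Relation.Binary.PropositionalEquality as ≡ using (_≡_; _≢_)
import Relation.Binary.Reasoning.Setoid as SetoidReasoning
open import Relation.Nullary using (Dec; yes; no; ¬_; contradiction)
open import Relation.Nullary.Decidable using (_×-dec_; ¬?; decidable-stable)
open import Relation.Unary using (Pred; Decidable)

-- Substitution

module _ {c₁ ℓ₁ c₂ ℓ₂} (R : CommutativeRing c₁ ℓ₁) (S : CommutativeRing c₂ ℓ₂) where
  private
    module R = CommutativeRing R
    module S = CommutativeRing S
    module R[X] = CommutativeRing (Polynomial.commutativeRing R)

  module _ {f : R.Carrier → S.Carrier}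
           (f-homo : RingMorphisms.IsRingHomomorphism R.rawRing S.rawRing f)
           (s : S.Carrier) where
    private
      module f = RingMorphisms.IsRingHomomorphism f-homo
    open Polynomial R
    open CommutativeSemigroupProperties S.+-commutativeSemigroup using (interchange)
    open CommutativeSemigroupProperties S.*-commutativeSemigroup using (x∙yz≈y∙xz)
    open import Algebra.Properties.Ring S.ring using (-0#≈0#; -‿+-comm; -‿distribʳ-*)
    open SetoidReasoning S.setoid

    private
      ev : Poly → S.Carrier
      ev = eval S f s

      tail-≈ : ∀ {a b p q} → (a ∷ p) ≈ (b ∷ q) → p ≈ q
      tail-≈ e .at i = e .at (suc i)

      tail-≈[] : ∀ {a p} → (a ∷ p) ≈ [] → p ≈ []
      tail-≈[] e .at i = e .at (suc i)

      -- Equal polynomials may be lists of different lengths, because of trailing zeros. This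
      -- disposes of the surplus coefficients in `ev-cong`.
      ev-≈[] : ∀ p → p ≈ [] → ev p S.≈ S.0#
      ev-≈[] []      e = S.refl
      ev-≈[] (a ∷ p) e = begin
        f a S.+ s S.* ev p    ≈⟨ S.+-cong (S.trans (f.⟦⟧-cong (e .at 0)) f.0#-homo)
                                          (S.*-congˡ (ev-≈[] p (tail-≈[] e))) ⟩
        S.0# S.+ s S.* S.0#   ≈⟨ S.trans (S.+-identityˡ _) (S.zeroʳ s) ⟩
        S.0#                  ∎

      ev-cong : ∀ p q → p ≈ q → ev p S.≈ ev q
      ev-cong []      q       e = S.sym (ev-≈[] q (R[X].sym e))
      ev-cong (a ∷ p) []      e = ev-≈[] (a ∷ p) e
      ev-cong (a ∷ p) (b ∷ q) e =
        S.+-cong (f.⟦⟧-cong (e .at 0)) (S.*-congˡ (ev-cong p q (tail-≈ e)))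

      ev-+ : ∀ p q → ev (p + q) S.≈ ev p S.+ ev q
      ev-+ []      q       = S.sym (S.+-identityˡ _)
      ev-+ (a ∷ p) []      = S.sym (S.+-identityʳ _)
      ev-+ (a ∷ p) (b ∷ q) = begin
        f (a R.+ b) S.+ s S.* ev (p + q)
          ≈⟨ S.+-cong (f.+-homo a b) (S.*-congˡ (ev-+ p q)) ⟩
        (f a S.+ f b) S.+ s S.* (ev p S.+ ev q)
          ≈⟨ S.+-congˡ (S.distribˡ s (ev p) (ev q)) ⟩
        (f a S.+ f b) S.+ (s S.* ev p S.+ s S.* ev q)
          ≈⟨ interchange (f a) (f b) (s S.* ev p) (s S.* ev q) ⟩
        (f a S.+ s S.* ev p) S.+ (f b S.+ s S.* ev q) ∎

      ev-neg : ∀ p → ev (- p) S.≈ S.- ev p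
      ev-neg []      = S.sym -0#≈0#
      ev-neg (a ∷ p) = begin
        f (R.- a) S.+ s S.* ev (- p)
          ≈⟨ S.+-cong (f.-‿homo a) (S.*-congˡ (ev-neg p)) ⟩
        S.- f a S.+ s S.* S.- ev p
          ≈⟨ S.+-congˡ (-‿distribʳ-* s (ev p)) ⟨
        S.- f a S.+ S.- (s S.* ev p)
          ≈⟨ -‿+-comm (f a) (s S.* ev p) ⟩
        S.- (f a S.+ s S.* ev p) ∎

      -- Commutativity of `S` enters here: `f a` has to move past `s`.
      ev-· : ∀ a p → ev (a · p) S.≈ f a S.* ev p
      ev-· a []      = S.sym (S.zeroʳ _)
      ev-· a (b ∷ p) = begin
        f (a R.* b) S.+ s S.* ev (a · p)
          ≈⟨ S.+-cong (f.*-homo a b) (S.*-congˡ (ev-· a p)) ⟩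
        f a S.* f b S.+ s S.* (f a S.* ev p)
          ≈⟨ S.+-congˡ (x∙yz≈y∙xz s (f a) (ev p)) ⟩
        f a S.* f b S.+ f a S.* (s S.* ev p)
          ≈⟨ S.distribˡ (f a) (f b) (s S.* ev p) ⟨
        f a S.* (f b S.+ s S.* ev p) ∎

      ev-* : ∀ p q → ev (p * q) S.≈ ev p S.* ev q
      ev-* []      q = S.sym (S.zeroˡ _)
      ev-* (a ∷ p) q = begin
        ev (a · q + X* (p * q))
          ≈⟨ ev-+ (a · q) (X* (p * q)) ⟩
        ev (a · q) S.+ (f R.0# S.+ s S.* ev (p * q))
          -- `X*` prepends the coefficient `R.0#`, whose image under `f` has to be cleared.
          ≈⟨ S.+-cong (ev-· a q)
               (S.trans (S.+-congʳ f.0#-homo) (S.+-identityˡ _)) ⟩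
        f a S.* ev q S.+ s S.* ev (p * q)
          ≈⟨ S.+-congˡ (S.trans (S.*-congˡ (ev-* p q)) (S.sym (S.*-assoc _ _ _))) ⟩
        f a S.* ev q S.+ (s S.* ev p) S.* ev q
          ≈⟨ S.distribʳ (ev q) (f a) (s S.* ev p) ⟨
        (f a S.+ s S.* ev p) S.* ev q ∎

    eval-C : ∀ a → eval S f s (C a) S.≈ f a
    eval-C a = S.trans (S.+-congˡ (S.zeroʳ s)) (S.+-identityʳ (f a))

    eval-X : eval S f s X S.≈ s
    eval-X = begin
      f R.0# S.+ s S.* eval S f s (C R.1#)
        ≈⟨ S.+-cong f.0#-homo (S.*-congˡ (S.trans (eval-C R.1#) f.1#-homo)) ⟩
      S.0# S.+ s S.* S.1#
        ≈⟨ S.trans (S.+-identityˡ _) (S.*-identityʳ s) ⟩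
      s ∎

    -- The conclusion has the form of the hypothesis on `f`, so the lemma can be applied twice:
    -- first to coefficients in K, then to coefficients in K[x].
    eval-isRingHomomorphism :
      RingMorphisms.IsRingHomomorphism R[X].rawRing S.rawRing (eval S f s)
    eval-isRingHomomorphism = record
      { isSemiringHomomorphism = record
        { isNearSemiringHomomorphism = record
          { +-isMonoidHomomorphism = record
            { isMagmaHomomorphism = record
              { isRelHomomorphism = record { cong = λ {p} {q} → ev-cong p q }
              ; homo = ev-+
              }
            ; ε-homo = S.refl
            }
          ; *-homo = ev-*
          }
        ; 1#-homo = S.trans (eval-C R.1#) f.1#-homo
        }
      ; -‿homo = ev-neg
      }

module _ {c ℓ} (R : CommutativeRing c ℓ) where
  private
    module R = CommutativeRing R
    module R[X] = CommutativeRing (Polynomial.commutativeRing R)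
  open Polynomial R

  C-isRingHomomorphism : RingMorphisms.IsRingHomomorphism R.rawRing R[X].rawRing C
  C-isRingHomomorphism = record
    { isSemiringHomomorphism = record
      { isNearSemiringHomomorphism = record
        { +-isMonoidHomomorphism = record
          { isMagmaHomomorphism = record
            { isRelHomomorphism = record { cong = C-cong }
            ; homo = λ a b → R[X].refl
            }
          -- `C R.0#` is a list with one zero entry, so it agrees with `[]` only coefficientwise.
          ; ε-homo = coeffwise λ { zero → R.refl ; (suc i) → R.refl }
          }
        ; *-homo = λ a b → coeffwise λ { zero    → R.sym (R.+-identityʳ _)
                                       ; (suc i) → R.refl }
        }
      ; 1#-homo = R[X].refl
      }
    ; -‿homo = λ a → R[X].refl
    }
    where
    C-cong : ∀ {a b} → a R.≈ b → C a ≈ C b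
    C-cong e .at zero    = e
    C-cong e .at (suc i) = R.refl

-- Substitution in two variables

module _ {c ℓ} (K : CommutativeRing c ℓ) where
  open Bivariate K
  private
    module K      = CommutativeRing K
    module K[x]   = Polynomial K
    module K[x,y] = CommutativeRing ring
    K[x]-ring     = K[x].commutativeRing
    open import Algebra.Morphism.Construct.Composition using (isRingHomomorphism)

    const-homo : RingMorphisms.IsRingHomomorphism K.rawRing K[x,y].rawRing const
    const-homo = isRingHomomorphism K[x,y].trans
      (C-isRingHomomorphism K) (C-isRingHomomorphism K[x]-ring)

    eval-x-homo : ∀ a → RingMorphisms.IsRingHomomorphism
      (CommutativeRing.rawRing K[x]-ring) K[x,y].rawRing (K[x].eval ring const a)
    eval-x-homo = eval-isRingHomomorphism K ring const-homo

  ⟨,⟩-isRingHomomorphism : ∀ a b →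
    RingMorphisms.IsRingHomomorphism K[x,y].rawRing K[x,y].rawRing (_⟨ a , b ⟩)
  ⟨,⟩-isRingHomomorphism a b = eval-isRingHomomorphism K[x]-ring ring (eval-x-homo a) b

  -- `x` is a constant of the outer ring K[x][y], so the outer evaluation hands it to the inner one,
  -- whereas `y` is the outer variable itself.
  x⟨,⟩ : ∀ a b → x ⟨ a , b ⟩ ≈ a
  x⟨,⟩ a b = K[x,y].trans (eval-C K[x]-ring ring (eval-x-homo a) b K[x].X)
                          (eval-X K ring const-homo a)

  y⟨,⟩ : ∀ a b → y ⟨ a , b ⟩ ≈ b
  y⟨,⟩ a b = eval-X K[x]-ring ring (eval-x-homo a) b

-- Finite sums

module Sum {c ℓ} (S : CommutativeRing c ℓ) where
  open CommutativeRing S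
    using (Carrier; _≈_; _+_; _*_; 0#; refl; sym; trans; +-cong; +-congˡ;
           +-identityˡ; +-identityʳ; zeroʳ; distribˡ; +-commutativeSemigroup)
  open CommutativeSemigroupProperties +-commutativeSemigroup using (interchange)

  -- The fold of `Bivariate`, for any commutative ring. Over K[x,y] the two agree by definition, so
  -- the results below apply to `tutte`.
  ∑ : ∀ {i} {I : Set i} → List I → (I → Carrier) → Carrier
  ∑ is f = foldr (λ i s → f i + s) 0# is

  infix 5 ∑
  syntax ∑ is (λ i → t) = ∑[ i ← is ] t

  -- A side condition on an index becomes a vanishing summand. The range of the subsets then no
  -- longer depends on the flat, and the two sums can be interchanged.
  when : ∀ {p} {P : Set p} → Dec P → Carrier → Carrier
  when (yes _) t = t
  when (no  _) t = 0#

  when-yes : ∀ {p} {P : Set p} (d : Dec P) {t} → P → when d t ≈ t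
  when-yes (yes _) _ = refl
  when-yes (no ¬p) p = contradiction p ¬p

  when-no : ∀ {p} {P : Set p} (d : Dec P) {t} → ¬ P → when d t ≈ 0#
  when-no (yes p) ¬p = contradiction p ¬p
  when-no (no _)  _  = refl

  module _ {i} {I : Set i} where

    ∑-cong : ∀ (is : List I) {f g} → (∀ {i} → i ∈ₗ is → f i ≈ g i) → ∑ is f ≈ ∑ is g
    ∑-cong []       f≈g = refl
    ∑-cong (i ∷ is) f≈g = +-cong (f≈g (here ≡.refl)) (∑-cong is (f≈g ∘ there))

    ∑-zero : ∀ (is : List I) {f} → (∀ {i} → i ∈ₗ is → f i ≈ 0#) → ∑ is f ≈ 0#
    ∑-zero []       f≈0 = refl
    ∑-zero (i ∷ is) f≈0 = trans (+-cong (f≈0 (here ≡.refl)) (∑-zero is (f≈0 ∘ there)))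
                                (+-identityˡ 0#)

    ∑-+ : ∀ (is : List I) f g → ∑[ i ← is ] (f i + g i) ≈ ∑ is f + ∑ is g
    ∑-+ []       f g = sym (+-identityˡ 0#)
    ∑-+ (i ∷ is) f g = trans (+-congˡ (∑-+ is f g)) (interchange (f i) (g i) _ _)

    *-∑ : ∀ (is : List I) s f → s * ∑ is f ≈ ∑[ i ← is ] (s * f i)
    *-∑ []       s f = zeroʳ s
    *-∑ (i ∷ is) s f = trans (distribˡ s (f i) _) (+-congˡ (*-∑ is s f))

    ∑-filter : ∀ {p} {P : Pred I p} (P? : Decidable P) is f →
               ∑ (filter P? is) f ≈ ∑[ i ← is ] when (P? i) (f i)
    ∑-filter P? []       f = refl
    ∑-filter P? (i ∷ is) f with P? i
    ... | yes _ = +-congˡ (∑-filter P? is f)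
    ... | no  _ = trans (∑-filter P? is f) (sym (+-identityˡ _))

    ∑-single : ∀ {is : List I} {f j} → Unique is → j ∈ₗ is →
               (∀ {i} → i ∈ₗ is → i ≢ j → f i ≈ 0#) → ∑ is f ≈ f j
    ∑-single (j∉is ∷ _) (here ≡.refl) f≈0 =
      trans (+-congˡ (∑-zero _ λ i∈is → f≈0 (there i∈is) (≡.≢-sym (All.lookup j∉is i∈is))))
            (+-identityʳ _)
    ∑-single (i∉is ∷ u) (there j∈is) f≈0 =
      trans (+-cong (f≈0 (here ≡.refl) (All.lookup i∉is j∈is))
                    (∑-single u j∈is (f≈0 ∘ there)))
            (+-identityˡ _)

  ∑-comm : ∀ {i j} {I : Set i} {J : Set j} (is : List I) (js : List J) (f : I → J → Carrier) →
           ∑[ i ← is ] (∑[ j ← js ] f i j) ≈ ∑[ j ← js ] (∑[ i ← is ] f i j)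
  ∑-comm []       js f = sym (∑-zero js λ _ → refl)
  ∑-comm (i ∷ is) js f = trans (+-congˡ (∑-comm is js f)) (sym (∑-+ js (f i) _))

-- Ring homomorphisms, powers and sums

module _ {c₁ ℓ₁ c₂ ℓ₂} (S : CommutativeRing c₁ ℓ₁) (T : CommutativeRing c₂ ℓ₂) where
  private
    module S = CommutativeRing S
    module T = CommutativeRing T
    open SemiringExp S.semiring using () renaming (_^_ to _^ˢ_)
    open SemiringExp T.semiring using () renaming (_^_ to _^ᵗ_)

  module _ {h : S.Carrier → T.Carrier}
           (h-homo : RingMorphisms.IsRingHomomorphism S.rawRing T.rawRing h) where
    private module h = RingMorphisms.IsRingHomomorphism h-homo

    homo-^ : ∀ s k → h (s ^ˢ k) T.≈ h s ^ᵗ k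
    homo-^ s zero    = h.1#-homo
    homo-^ s (suc k) = T.trans (h.*-homo s (s ^ˢ k)) (T.*-congˡ (homo-^ s k))

    homo-∑ : ∀ {i} {I : Set i} (is : List I) f →
             h (Sum.∑ S is f) T.≈ Sum.∑ T is (λ i → h (f i))
    homo-∑ []       f = h.0#-homo
    homo-∑ (i ∷ is) f = T.trans (h.+-homo (f i) _) (T.+-congˡ (homo-∑ is f))

    homo-minus-1 : ∀ s {t} → h s T.≈ t → h (s S.- S.1#) T.≈ t T.- T.1#
    homo-minus-1 s hs≈t = T.trans (h.+-homo s _)
      (T.+-cong hs≈t (T.trans (h.-‿homo S.1#) (T.-‿cong h.1#-homo)))

-- Closures

module _ {n} (M : Matroid n) where
  open Matroid M

  private
    ∪-⊆ : ∀ {A B C : Subset n} → A ⊆ C → B ⊆ C → A ∪ B ⊆ C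
    ∪-⊆ {A} {B} A⊆C B⊆C x∈ = [ A⊆C , B⊆C ]′ (x∈p∪q⁻ A B x∈)

    ⁅⁆-⊆ : ∀ {e} {A : Subset n} → e ∈ A → ⁅ e ⁆ ⊆ A
    ⁅⁆-⊆ {e} e∈A x∈ rewrite x∈⁅y⁆⇒x≡y e x∈ = e∈A

    -- Elements that leave the rank unchanged are added one at a time until none is left. The
    -- process stops because strict supersets are well founded in a finite set.
    closure-from : ∀ {A} → Acc (λ F G → G ⊂ F) A → A ⊆ E →
                   ∃[ F ] IsFlat M F × A ⊆ F × rk F ≡ rk A
    closure-from {A} (acc larger) A⊆E
      with Fin.any? (λ e → (e ∈? E) ×-dec ¬? (e ∈? A) ×-dec (rk (A ∪ ⁅ e ⁆) ℕ.≤? rk A))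
    -- A failed search for such an element is exactly flatness of `A`.
    ... | no ¬extendable =
      A , (A⊆E , λ e e∈E e∉A → ℕ.≰⇒> λ rk≤ → ¬extendable (e , e∈E , e∉A , rk≤)) ,
      (λ x∈ → x∈) , ≡.refl
    ... | yes (e , e∈E , e∉A , rk≤) =
      let F , flat , Ae⊆F , rkF≡ = closure-from (larger A⊂Ae) Ae⊆E
      in F , flat , (λ x∈ → Ae⊆F (A⊆Ae x∈)) ,
         -- `rk≤` bounds the rank of the enlarged set from above, monotonicity from below.
         ≡.trans rkF≡ (ℕ.≤-antisym rk≤ (rk-mono A⊆Ae Ae⊆E))
      where
      A⊆Ae : A ⊆ A ∪ ⁅ e ⁆
      A⊆Ae = p⊆p∪q ⁅ e ⁆

      Ae⊆E : A ∪ ⁅ e ⁆ ⊆ E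
      Ae⊆E = ∪-⊆ A⊆E (⁅⁆-⊆ e∈E)

      A⊂Ae : A ⊂ A ∪ ⁅ e ⁆
      A⊂Ae = A⊆Ae , e , q⊆p∪q A ⁅ e ⁆ (x∈⁅x⁆ e) , e∉A

  -- Needed because the ground set of `M ↾ F` is `E ∩ F`, whose rank is compared with `rk F`.
  ∩-⊆ : ∀ {F} → F ⊆ E → E ∩ F ≡ F
  ∩-⊆ {F} F⊆E = ⊆-antisym (p∩q⊆q E F) λ x∈ → x∈p∩q⁺ (F⊆E x∈ , x∈)

  closure : ∀ {A} → A ⊆ E → ∃[ F ] IsFlat M F × A ⊆ F × rk F ≡ rk A
  closure = closure-from (⊃-wellFounded _)

  -- Were `e` in `F` but not in `G`, flatness of `G` would give `G ∪ ⁅ e ⁆` larger rank than `G`.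
  -- But that set lies in `F ∪ G`. Since `F ∩ G` contains `A`, its rank is at least `rk F`, so
  -- submodularity bounds the rank of `F ∪ G` by `rk G`.
  flat-⊆ : ∀ {A F G} → IsFlat M F → IsFlat M G → A ⊆ F → A ⊆ G →
           rk F ≡ rk A → rk G ≡ rk A → F ⊆ G
  flat-⊆ {A} {F} {G} (F⊆E , _) (G⊆E , G-flat) A⊆F A⊆G rkF rkG {e} e∈F =
    decidable-stable (e ∈? G) λ e∉G → ℕ.<⇒≱ (G-flat e (F⊆E e∈F) e∉G)
      (ℕ.≤-trans (rk-mono (∪-⊆ (q⊆p∪q F G) (⁅⁆-⊆ (p⊆p∪q G e∈F))) F∪G⊆E) rkF∪G≤rkG)
    where
    F∪G⊆E : F ∪ G ⊆ E
    F∪G⊆E = ∪-⊆ F⊆E G⊆E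

    rkF≤rkF∩G : rk F ℕ.≤ rk (F ∩ G)
    rkF≤rkF∩G = ℕ.≤-trans (ℕ.≤-reflexive rkF)
      (rk-mono (λ x∈ → x∈p∩q⁺ (A⊆F x∈ , A⊆G x∈)) (λ x∈ → F⊆E (p∩q⊆p F G x∈)))

    rkF∪G≤rkG : rk (F ∪ G) ℕ.≤ rk G
    rkF∪G≤rkG = ℕ.+-cancelˡ-≤ (rk F) _ _ (begin
      rk F ℕ.+ rk (F ∪ G)        ≤⟨ ℕ.+-monoˡ-≤ _ rkF≤rkF∩G ⟩
      rk (F ∩ G) ℕ.+ rk (F ∪ G)  ≡⟨ ℕ.+-comm (rk (F ∩ G)) _ ⟩
      rk (F ∪ G) ℕ.+ rk (F ∩ G)  ≤⟨ rk-submodular F⊆E G⊆E ⟩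
      rk F ℕ.+ rk G              ∎)
      where open ℕ.≤-Reasoning

  closure-unique : ∀ {A F G} → IsFlat M F → IsFlat M G → A ⊆ F → A ⊆ G →
                   rk F ≡ rk A → rk G ≡ rk A → F ≡ G
  closure-unique Ff Gf A⊆F A⊆G rkF rkG =
    ⊆-antisym (flat-⊆ Ff Gf A⊆F A⊆G rkF rkG) (flat-⊆ Gf Ff A⊆G A⊆F rkG rkF)

-- The rank generating polynomial

module RankGenerating {c ℓ} (S : CommutativeRing c ℓ) where
  open CommutativeRing S
  open SemiringExp semiring using (_^_; ^-congˡ)
  open Sum S
  open SetoidReasoning setoid

  -- Whitney's corank-nullity generating function. `tutte M` is by definition its value at `x - 1#`
  -- and `y - 1#`, and substituting x = 1 amounts to taking `u` to be zero.
  rankGen : ∀ {n} → Matroid n → Carrier → Carrier → Carrier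
  rankGen M u v = ∑[ A ← subsets E ] (u ^ (rank ∸ rk A) * v ^ (∣ A ∣ ∸ rk A))
    where open Matroid M

  rankGen-cong : ∀ {n} (M : Matroid n) {u u′ v v′} → u ≈ u′ → v ≈ v′ →
                 rankGen M u v ≈ rankGen M u′ v′
  rankGen-cong M u≈u′ v≈v′ =
    ∑-cong (subsets E) λ {A} _ →
      *-cong (^-congˡ (rank ∸ rk A) u≈u′) (^-congˡ (∣ A ∣ ∸ rk A) v≈v′)
    where open Matroid M

  0^≈0 : ∀ {k} → k ≢ 0 → 0# ^ k ≈ 0#
  0^≈0 {zero}  k≢0 = contradiction ≡.refl k≢0
  0^≈0 {suc k} k≢0 = zeroˡ _

  module _ {n} (M : Matroid n) (u v : Carrier) where
    open Matroid M

    term : Subset n → Carrier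
    term A = u ^ (rank ∸ rk A) * v ^ (∣ A ∣ ∸ rk A)

    -- The contribution of the pair (F, A) to the right hand side after distributing. `E ∩ F`
    -- appears as the ground set of `M ↾ F`.
    flatTerm : Subset n → Subset n → Carrier
    flatTerm F A =
      u ^ (rank ∸ rk F) * (0# ^ (rk (E ∩ F) ∸ rk A) * v ^ (∣ A ∣ ∸ rk A))

    flatTerm-≡ : ∀ {F A} → F ⊆ E → rk F ≡ rk A → flatTerm F A ≈ term A
    flatTerm-≡ {F} {A} F⊆E rkF≡rkA
      -- The exponent of `0#` becomes zero, and `0# ^ 0` computes to `1#`.
      rewrite ∩-⊆ M F⊆E | rkF≡rkA | ℕ.n∸n≡0 (rk A) = *-congˡ (*-identityˡ _)

    flatTerm-≢ : ∀ {F A} → F ⊆ E → A ⊆ F → rk F ≢ rk A → flatTerm F A ≈ 0#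
    flatTerm-≢ {F} {A} F⊆E A⊆F rkF≢rkA rewrite ∩-⊆ M F⊆E =
      trans (*-congˡ (trans (*-congʳ (0^≈0 rkF∸rkA≢0)) (zeroˡ _))) (zeroʳ _)
      where
      rkF∸rkA≢0 : rk F ∸ rk A ≢ 0
      -- A zero truncated difference gives only `rk F ≤ rk A`; the reverse inequality is
      -- monotonicity.
      rkF∸rkA≢0 eq = rkF≢rkA (ℕ.≤-antisym (ℕ.m∸n≡0⇒m≤n eq) (rk-mono A⊆F F⊆E))

    -- Among the flats containing `A` only the closure has rank `rk A`; any other leaves a positive
    -- power of zero. If `A` is not inside `E`, it lies in no `E ∩ F`, so both sides vanish.
    ∑-flats⊇ : ∀ A →
      ∑[ F ← flats M ] when (A ⊆? E ∩ F) (flatTerm F A) ≈ when (A ⊆? E) (term A)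
    ∑-flats⊇ A with A ⊆? E
    ... | no A⊈E = ∑-zero (flats M) λ {F} _ →
      when-no (A ⊆? E ∩ F) λ A⊆ → A⊈E λ x∈ → p∩q⊆p E F (A⊆ x∈)
    ... | yes A⊆E with closure M A⊆E
    ...   | F , F-flat , A⊆F , rkF≡rkA = begin
      ∑[ G ← flats M ] when (A ⊆? E ∩ G) (flatTerm G A)
        -- `allSubsets n` has no repetitions, so the closure occurs just once in `flats M`.
        ≈⟨ ∑-single (Unique.filter⁺ (isFlat? M) (allSubsets-unique n))
             (∈-filter⁺ (isFlat? M) (allSubsets-complete F) F-flat) vanish ⟩
      when (A ⊆? E ∩ F) (flatTerm F A)
        ≈⟨ when-yes (A ⊆? E ∩ F) (λ x∈ → x∈p∩q⁺ (A⊆E x∈ , A⊆F x∈)) ⟩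
      flatTerm F A
        ≈⟨ flatTerm-≡ (proj₁ F-flat) rkF≡rkA ⟩
      term A ∎
      where
      -- By uniqueness of the closure, a flat containing `A` and different from `F` cannot have rank
      -- `rk A`.
      vanish : ∀ {G} → G ∈ₗ flats M → G ≢ F → when (A ⊆? E ∩ G) (flatTerm G A) ≈ 0#
      vanish {G} G∈flats G≢F with A ⊆? E ∩ G
      ... | no  _    = refl
      ... | yes A⊆E∩G =
        flatTerm-≢ (proj₁ G-flat) A⊆G λ rkG≡rkA →
          G≢F (closure-unique M G-flat F-flat A⊆G A⊆F rkG≡rkA rkF≡rkA)
        where
        G-flat : IsFlat M G
        G-flat = proj₂ (∈-filter⁻ (isFlat? M) {xs = allSubsets n} G∈flats)
        A⊆G : A ⊆ G
        A⊆G x∈ = p∩q⊆q E G (A⊆E∩G x∈)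

    -- The chain is best read from its end: the right hand side expands into a double sum over flats
    -- and all subsets, the sums are exchanged, and `∑-flats⊇` collapses the sum over flats.
    rankGen-flats : rankGen M u v ≈
      ∑[ F ← flats M ] (u ^ (rank ∸ rk F) * rankGen (M ↾ F) 0# v)
    rankGen-flats = begin
      rankGen M u v
        ≈⟨ ∑-filter (_⊆? E) (allSubsets n) term ⟩
      ∑[ A ← allSubsets n ] when (A ⊆? E) (term A)
        ≈⟨ ∑-cong (allSubsets n) (λ {A} _ → ∑-flats⊇ A) ⟨
      ∑[ A ← allSubsets n ] (∑[ F ← flats M ] when (A ⊆? E ∩ F) (flatTerm F A))
        ≈⟨ ∑-comm (flats M) (allSubsets n) (λ F A → when (A ⊆? E ∩ F) (flatTerm F A)) ⟨
      ∑[ F ← flats M ] (∑[ A ← allSubsets n ] when (A ⊆? E ∩ F) (flatTerm F A))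
        ≈⟨ ∑-cong (flats M) (λ {F} _ → ∑-filter (_⊆? (E ∩ F)) (allSubsets n) (flatTerm F)) ⟨
      ∑[ F ← flats M ] (∑[ A ← subsets (E ∩ F) ] flatTerm F A)
        ≈⟨ ∑-cong (flats M) (λ {F} _ → *-∑ (subsets (E ∩ F)) _ _) ⟨
      ∑[ F ← flats M ] (u ^ (rank ∸ rk F) * rankGen (M ↾ F) 0# v) ∎

-- The Tutte polynomial at x = 1

module _ {c₁ ℓ₁ c₂ ℓ₂} (S : CommutativeRing c₁ ℓ₁) (T : CommutativeRing c₂ ℓ₂) where
  private
    module S = CommutativeRing S
    module T = CommutativeRing T
    module Sᵣ = RankGenerating S
    module Tᵣ = RankGenerating T

  -- The sum is built from ring operations, with natural number exponents that depend only on `M`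
  -- and the subset.
  homo-rankGen : ∀ {h} → RingMorphisms.IsRingHomomorphism S.rawRing T.rawRing h →
    ∀ {n} (M : Matroid n) u v → h (Sᵣ.rankGen M u v) T.≈ Tᵣ.rankGen M (h u) (h v)
  homo-rankGen h-homo M u v = T.trans (homo-∑ S T h-homo (subsets E) _)
    (Sum.∑-cong T (subsets E) λ {A} _ → T.trans (h.*-homo _ _)
      (T.*-cong (homo-^ S T h-homo u (rank ∸ rk A))
                (homo-^ S T h-homo v (∣ A ∣ ∸ rk A))))
    where
    open Matroid M
    module h = RingMorphisms.IsRingHomomorphism h-homo

module _ {c ℓ} (K : CommutativeRing c ℓ) where
  open Bivariate K
  open RankGenerating ring
  private module K[x,y] = CommutativeRing ring

  -- The substitution sends `x - 1#` to 1 - 1 = 0 and fixes `y - 1#`.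
  tutte⟨1,y⟩ : ∀ {n} (M : Matroid n) → tutte M ⟨ 1# , y ⟩ ≈ rankGen M 0# (y - 1#)
  tutte⟨1,y⟩ M = K[x,y].trans (homo-rankGen ring ring h-homo M (x - 1#) (y - 1#))
    (rankGen-cong M
      (K[x,y].trans (homo-minus-1 ring ring h-homo x (x⟨,⟩ K 1# y)) (K[x,y].-‿inverseʳ 1#))
      (homo-minus-1 ring ring h-homo y (y⟨,⟩ K 1# y)))
    where h-homo = ⟨,⟩-isRingHomomorphism K 1# y

proposition5p12 : ∀ {c ℓ} (K : CommutativeRing c ℓ) {n : ℕ} (M : Matroid n) →
    let open Bivariate K
        open Matroid M
    in tutte M ≈ ∑[ F ← flats M ] ((x - 1#) ^ (rank ∸ rk F) * tutte (M ↾ F) ⟨ 1# , y ⟩)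
proposition5p12 K M =
  -- `tutte M` unfolds to `rankGen M (x - 1#) (y - 1#)`, so what remains is to identify the factor
  -- of each flat `F` with the Tutte polynomial of `M ↾ F` at x = 1.
  K[x,y].trans (RankGenerating.rankGen-flats ring M (x - 1#) (y - 1#))
    (Sum.∑-cong ring (flats M) λ {F} _ →
      K[x,y].*-congˡ {(x - 1#) ^ (rank ∸ rk F)} (K[x,y].sym (tutte⟨1,y⟩ K (M ↾ F))))
  where
  open Bivariate K
  open Matroid M
  module K[x,y] = CommutativeRing ring
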